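{- Every tree can be generated from the single tree $\mathbf{1}$ using the operations of addition and stretch. That is, the smallest class of trees that contains $\mathbf{1}$, contains $A+B$ whenever it contains $A$ and $B$, and contains $\bar A$ whenever it contains $A$, is the class of all trees.
   Context: A "tree" is a finite non-empty rooted unordered tree; two trees are regarded as equal if they are isomorphic as rooted trees. $\mathbf{1}$ is the tree with exactly one vertex. For a tree $T$, $r(T)$ is its root; the "subtrees of $r(T)$" are the trees rooted at the children of $r(T)$, each consisting of a child and all its descendants. Addition: $A+B$ is the tree obtained by merging the roots $r(A)$ and $r(B)$ into a single new root, so that the subtrees of $r(A)$ together with the subtrees of $r(B)$ (counted with multiplicity) become the subtrees of the new root. Stretch: $\bar A$ is the tree consisting of a new root with $A$ attached as its only subtree. -}

module Defs where

open import Data.Nat using (ℕ; zero; suc; _+_)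
open import Data.Fin using (Fin; zero; suc; _↑ˡ_; _↑ʳ_; splitAt; join)
open import Data.Fin.Properties using (splitAt-↑ˡ; splitAt-↑ʳ; join-splitAt)
open import Data.Sum using (inj₁; inj₂; [_,_]′)
open import Function using (_∘_)
open import Function.Bundles using (_↔_; _⇔_; Inverse)
open import Level using (0ℓ)
open import Relation.Binary using (Rel)
open import Relation.Binary.Construct.Closure.ReflexiveTransitive using (Star; ε; _◅_; gmap)
open import Relation.Binary.PropositionalEquality using (_≡_; cong; subst)

-- Vertices are the elements of Fin (suc n), with zero as the root, so only the
-- vertices suc i have a parent, namely parent i.  The relation ParentOf parent u v
-- says that u is the parent of v.
data ParentOf {n : ℕ} (parent : Fin n → Fin (suc n)) : Rel (Fin (suc n)) 0ℓ where
  edge : ∀ i → ParentOf parent (parent i) (suc i)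

-- A finite rooted tree with labelled vertices.  The labels carry no meaning:
-- trees are to be considered up to _≅_ below.  Since every non-root vertex has
-- exactly one parent, being reachable from the root excludes cycles.
record Tree : Set where
  field
    nonRoots  : ℕ
    parent    : Fin nonRoots → Fin (suc nonRoots)
    reachable : ∀ v → Star (ParentOf parent) zero v

  Vertex : Set
  Vertex = Fin (suc nonRoots)

  root : Vertex
  root = zero

  _parentOf_ : Rel Vertex 0ℓ
  _parentOf_ = ParentOf parent

infix 4 _≅_

record _≅_ (A B : Tree) : Set where
  private
    module A = Tree A
    module B = Tree B
  field
    vertices : A.Vertex ↔ B.Vertex
  open Inverse vertices using (to)
  field
    root-preserved   : to A.root ≡ B.root
    parent-preserved : ∀ u v → (u A.parentOf v) ⇔ (to u B.parentOf to v)

𝟏 : Tree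
𝟏 = record
  { nonRoots  = 0
  ; parent    = λ ()
  ; reachable = λ { zero → ε }
  }

-- The old vertex v becomes suc v; the old root, now suc zero, is the only child
-- of the new root zero.
stretch : Tree → Tree
stretch A = record
  { nonRoots  = suc A.nonRoots
  ; parent    = parent′
  ; reachable = reachable′
  }
  where
  module A = Tree A

  parent′ : Fin (suc A.nonRoots) → Fin (suc (suc A.nonRoots))
  parent′ zero    = zero
  parent′ (suc i) = suc (A.parent i)

  old : ∀ {u v} → u A.parentOf v → ParentOf parent′ (suc u) (suc v)
  old (edge i) = edge (suc i)

  reachable′ : ∀ v → Star (ParentOf parent′) zero v
  reachable′ zero    = ε
  reachable′ (suc v) = edge zero ◅ gmap suc old (A.reachable v)

infixl 6 _⊕_

-- The embeddings injˡ and injʳ of the vertices of A and of B both send the root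
-- to zero, and have disjoint images otherwise.
_⊕_ : Tree → Tree → Tree
A ⊕ B = record
  { nonRoots  = m + n
  ; parent    = parent′
  ; reachable = reachable′
  }
  where
  module A = Tree A
  module B = Tree B

  m n : ℕ
  m = A.nonRoots
  n = B.nonRoots

  injˡ : A.Vertex → Fin (suc (m + n))
  injˡ zero    = zero
  injˡ (suc i) = suc (i ↑ˡ n)

  injʳ : B.Vertex → Fin (suc (m + n))
  injʳ zero    = zero
  injʳ (suc j) = suc (m ↑ʳ j)

  parent′ : Fin (m + n) → Fin (suc (m + n))
  parent′ = [ injˡ ∘ A.parent , injʳ ∘ B.parent ]′ ∘ splitAt m

  oldˡ : ∀ {u v} → u A.parentOf v → ParentOf parent′ (injˡ u) (injˡ v)
  oldˡ (edge i) = subst (λ p → ParentOf parent′ p (suc (i ↑ˡ n)))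
    (cong [ injˡ ∘ A.parent , injʳ ∘ B.parent ]′ (splitAt-↑ˡ m i n)) (edge (i ↑ˡ n))

  oldʳ : ∀ {u v} → u B.parentOf v → ParentOf parent′ (injʳ u) (injʳ v)
  oldʳ (edge j) = subst (λ p → ParentOf parent′ p (suc (m ↑ʳ j)))
    (cong [ injˡ ∘ A.parent , injʳ ∘ B.parent ]′ (splitAt-↑ʳ m n j)) (edge (m ↑ʳ j))

  reachable-join : ∀ s → Star (ParentOf parent′) zero (suc (join m n s))
  reachable-join (inj₁ i) = gmap injˡ oldˡ (A.reachable (suc i))
  reachable-join (inj₂ j) = gmap injʳ oldʳ (B.reachable (suc j))

  reachable′ : ∀ v → Star (ParentOf parent′) zero v
  reachable′ zero    = ε
  reachable′ (suc k) = subst (Star (ParentOf parent′) zero ∘ suc)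
    (join-splitAt m n k) (reachable-join (splitAt m k))

-- The smallest class of trees containing 𝟏 and closed under _⊕_ and stretch.
-- Isomorphic trees count as equal, so a class of trees is closed under _≅_.
data Generated : Tree → Set where
  one     : Generated 𝟏
  add     : ∀ {A B} → Generated A → Generated B → Generated (A ⊕ B)
  up      : ∀ {A} → Generated A → Generated (stretch A)
  iso     : ∀ {A B} → A ≅ B → Generated A → Generated B

{-# OPTIONS --safe #-}

-- Trees are grown leaf by leaf.  The parent map of a tree with n + 1 vertices has
-- n arguments, so by pigeonhole some vertex is nobody's parent; if n > 0 it is not
-- the root, and deleting it leaves a smaller tree.  Conversely the generated trees
-- are closed under attaching a leaf at any vertex v, by induction on the generation:
-- in a sum the leaf goes to the summand containing v, in a stretch to the stretched
-- tree, and a leaf at the root is a summand isomorphic to the stretch of 𝟏.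

module Submission where

open import Data.Fin using (Fin; zero; suc; _↑ˡ_; _↑ʳ_; splitAt; join; punchIn; punchOut)
open import Data.Fin.Patterns using (1F; 2F)
open import Data.Fin.Permutation
  using (Permutation; _⟨$⟩ʳ_; _⟨$⟩ˡ_; id; insert; insert-punchIn; lift₀; inverseˡ; inverseʳ)
open import Data.Fin.Properties
  using (_≟_; any?; ¬∀⟶∃¬; <⇒notInjective; splitAt-↑ˡ; splitAt-↑ʳ;
    join-splitAt; +↔⊎; punchIn-injective; punchInᵢ≢i; punchIn-punchOut)
open import Data.Nat using (zero; suc)
open import Data.Nat.Properties using (n<1+n)
open import Data.Product using (∃; _,_; proj₁; proj₂)
open import Data.Sum using (inj₁; inj₂)
open import Data.Sum.Properties using (swap-↔)
open import Function using (_∘_)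
open import Function.Bundles using (_↔_; Injection; Inverse; Equivalence; mk⇔)
open import Function.Construct.Composition using (_↔-∘_)
open import Function.Construct.Symmetry using (↔-sym)
open import Function.Properties.Inverse using (↔⇒↣)
open import Relation.Binary.Construct.Closure.ReflexiveTransitive
  using (Star; ε; _◅_; _◅◅_; gmap)
open import Relation.Binary.PropositionalEquality
open import Relation.Nullary using (¬_; yes; no; contradiction)

open import Defs

open Tree using (nonRoots; parent; reachable; Vertex)

-- Isomorphisms of trees

Parent : (A : Tree) → Vertex A → Vertex A → Set
Parent A = ParentOf (parent A)

parentOf-unique : ∀ {n} {p : Fin n → Fin (suc n)} {u v w} →
                  ParentOf p u w → ParentOf p v w → u ≡ v
parentOf-unique (edge i) (edge .i) = refl

¬parentOf-zero : ∀ {n} {p : Fin n → Fin (suc n)} {u} → ¬ ParentOf p u zero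
¬parentOf-zero ()

-- Edges are reflected because every vertex has at most one parent.
homomorphism⇒≅ : ∀ A B (f : Vertex A ↔ Vertex B) → f ⟨$⟩ʳ zero ≡ zero →
                 (∀ i → Parent B (f ⟨$⟩ʳ parent A i) (f ⟨$⟩ʳ suc i)) → A ≅ B
homomorphism⇒≅ A B f f-root f-edge = record
  { vertices         = f
  ; root-preserved   = f-root
  ; parent-preserved = λ u v → mk⇔ (λ { (edge i) → f-edge i }) (reflect v)
  }
  where
  reflect : ∀ {u} v → Parent B (f ⟨$⟩ʳ u) (f ⟨$⟩ʳ v) → Parent A u v
  reflect zero    e = contradiction (subst (Parent B _) f-root e) ¬parentOf-zero
  reflect (suc i) e = subst (λ w → Parent A w (suc i))
    (Injection.injective (↔⇒↣ f) (parentOf-unique (f-edge i) e)) (edge i)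

≅-sym : ∀ {A B} → A ≅ B → B ≅ A
≅-sym {A} {B} f = homomorphism⇒≅ B A (↔-sym vertices)
  (trans (cong from (sym root-preserved)) (inverseˡ vertices))
  (λ i → Equivalence.from (parent-preserved (from (parent B i)) (from (suc i)))
    (subst₂ (Parent B) (sym (inverseʳ vertices)) (sym (inverseʳ vertices)) (edge i)))
  where
  open _≅_ f
  open Inverse vertices using (from)

-- The new leaf is the vertex 1F, so that punchIn 1F embeds the old vertices.
grow : (A : Tree) → Vertex A → Tree
grow A v = record
  { nonRoots  = suc (nonRoots A)
  ; parent    = parent′
  ; reachable = reachable′
  }
  where
  parent′ : Fin (suc (nonRoots A)) → Fin (suc (suc (nonRoots A)))
  parent′ zero    = punchIn 1F v
  parent′ (suc i) = punchIn 1F (parent A i)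

  old : ∀ {u w} → Parent A u w → ParentOf parent′ (punchIn 1F u) (punchIn 1F w)
  old (edge i) = edge (suc i)

  reachable′ : ∀ w → Star (ParentOf parent′) zero w
  reachable′ zero          = ε
  reachable′ (suc zero)    = gmap (punchIn 1F) old (reachable A v) ◅◅ edge zero ◅ ε
  reachable′ (suc (suc i)) = gmap (punchIn 1F) old (reachable A (suc i))

-- Criterion for recognising a grown tree: `ℓ` is the place of the new leaf in `T`, and `π` followed
-- by `punchIn ℓ` matches the old vertices with the other vertices of `T`.
grow-≅ : ∀ A v T (π : Permutation (suc (nonRoots A)) (nonRoots T)) (ℓ : Vertex T) →
         punchIn ℓ (π ⟨$⟩ʳ zero) ≡ zero →
         Parent T (punchIn ℓ (π ⟨$⟩ʳ v)) ℓ →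
         (∀ i → Parent T (punchIn ℓ (π ⟨$⟩ʳ parent A i)) (punchIn ℓ (π ⟨$⟩ʳ suc i))) →
         grow A v ≅ T
grow-≅ A v T π ℓ root-eq leaf-edge old-edge =
  homomorphism⇒≅ (grow A v) T f (trans (f-old zero) root-eq) f-edge
  where
  f : Permutation (suc (suc (nonRoots A))) (suc (nonRoots T))
  f = insert 1F ℓ π

  f-old : ∀ w → f ⟨$⟩ʳ punchIn 1F w ≡ punchIn ℓ (π ⟨$⟩ʳ w)
  f-old = insert-punchIn 1F ℓ π

  f-edge : ∀ i → Parent T (f ⟨$⟩ʳ parent (grow A v) i) (f ⟨$⟩ʳ suc i)
  f-edge zero    = subst (λ u → Parent T u ℓ) (sym (f-old v)) leaf-edge
  f-edge (suc i) =
    subst₂ (Parent T) (sym (f-old (parent A i))) (sym (f-old (suc i))) (old-edge i)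

-- Sums

module _ (A B : Tree) where

  private
    m = nonRoots A
    n = nonRoots B

  injˡ : Vertex A → Vertex (A ⊕ B)
  injˡ zero    = zero
  injˡ (suc i) = suc (i ↑ˡ n)

  injʳ : Vertex B → Vertex (A ⊕ B)
  injʳ zero    = zero
  injʳ (suc j) = suc (m ↑ʳ j)

  parent-↑ˡ : ∀ i → parent (A ⊕ B) (i ↑ˡ n) ≡ injˡ (parent A i)
  -- The case split makes the embedding local to `_⊕_` and its copy `injˡ` reduce to the same
  -- vertex.
  parent-↑ˡ i rewrite splitAt-↑ˡ m i n with parent A i
  ... | zero  = refl
  ... | suc _ = refl

  parent-↑ʳ : ∀ j → parent (A ⊕ B) (m ↑ʳ j) ≡ injʳ (parent B j)
  parent-↑ʳ j rewrite splitAt-↑ʳ m n j with parent B j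
  ... | zero  = refl
  ... | suc _ = refl

  ⊕-edgeˡ : ∀ i → Parent (A ⊕ B) (injˡ (parent A i)) (injˡ (suc i))
  ⊕-edgeˡ i = subst (λ u → Parent (A ⊕ B) u (suc (i ↑ˡ n))) (parent-↑ˡ i) (edge (i ↑ˡ n))

  ⊕-edgeʳ : ∀ j → Parent (A ⊕ B) (injʳ (parent B j)) (injʳ (suc j))
  ⊕-edgeʳ j = subst (λ u → Parent (A ⊕ B) u (suc (m ↑ʳ j))) (parent-↑ʳ j) (edge (m ↑ʳ j))

  -- Every `k` is the `join` of its `splitAt`, so each edge of a sum comes from a summand. This
  -- splits the edge conditions of `homomorphism⇒≅` and `grow-≅` by summand.
  ⊕-edge-elim : (Q : Vertex (A ⊕ B) → Vertex (A ⊕ B) → Set) →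
                (∀ i → Q (injˡ (parent A i)) (injˡ (suc i))) →
                (∀ j → Q (injʳ (parent B j)) (injʳ (suc j))) →
                ∀ k → Q (parent (A ⊕ B) k) (suc k)
  ⊕-edge-elim Q left right k =
    subst (λ k → Q (parent (A ⊕ B) k) (suc k)) (join-splitAt m n k) (go (splitAt m k))
    where
    go : ∀ s → Q (parent (A ⊕ B) (join m n s)) (suc (join m n s))
    go (inj₁ i) = subst (λ u → Q u (suc (i ↑ˡ n))) (sym (parent-↑ˡ i)) (left i)
    go (inj₂ j) = subst (λ u → Q u (suc (m ↑ʳ j))) (sym (parent-↑ʳ j)) (right j)

module _ (A B : Tree) where

  private
    m = nonRoots A
    n = nonRoots B

  ⊕-swap : Vertex (A ⊕ B) ↔ Vertex (B ⊕ A)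
  ⊕-swap = lift₀ (↔-sym +↔⊎ ↔-∘ (swap-↔ ↔-∘ +↔⊎ {m} {n}))

  ⊕-swap-injˡ : ∀ u → ⊕-swap ⟨$⟩ʳ injˡ A B u ≡ injʳ B A u
  ⊕-swap-injˡ zero    = refl
  ⊕-swap-injˡ (suc i) rewrite splitAt-↑ˡ m i n = refl

  ⊕-swap-injʳ : ∀ u → ⊕-swap ⟨$⟩ʳ injʳ A B u ≡ injˡ B A u
  ⊕-swap-injʳ zero    = refl
  ⊕-swap-injʳ (suc j) rewrite splitAt-↑ʳ m n j = refl

  ⊕-comm : A ⊕ B ≅ B ⊕ A
  ⊕-comm = homomorphism⇒≅ (A ⊕ B) (B ⊕ A) ⊕-swap refl
    (⊕-edge-elim A B (λ u v → Parent (B ⊕ A) (⊕-swap ⟨$⟩ʳ u) (⊕-swap ⟨$⟩ʳ v))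
      (λ i → subst₂ (Parent (B ⊕ A))
        (sym (⊕-swap-injˡ (parent A i))) (sym (⊕-swap-injˡ (suc i))) (⊕-edgeʳ B A i))
      (λ j → subst₂ (Parent (B ⊕ A))
        (sym (⊕-swap-injʳ (parent B j))) (sym (⊕-swap-injʳ (suc j))) (⊕-edgeˡ B A j)))

-- Attaching a leaf

grow-cong : ∀ {A B} (f : A ≅ B) v → grow A v ≅ grow B (_≅_.vertices f ⟨$⟩ʳ v)
grow-cong {A} {B} f v = grow-≅ A v (grow B (to v)) vertices 1F
  (cong (punchIn 1F) root-preserved)
  (edge zero)
  (λ i → old (Equivalence.to (parent-preserved (parent A i) (suc i)) (edge i)))
  where
  open _≅_ f
  open Inverse vertices using (to)

  old : ∀ {u w} → Parent B u w → Parent (grow B (to v)) (punchIn 1F u) (punchIn 1F w)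
  old (edge i) = edge (suc i)

grow-root : ∀ A → grow A zero ≅ stretch 𝟏 ⊕ A
-- With `stretch 𝟏` on the left, its only child is numbered `1F`, just like the new leaf.
grow-root A = grow-≅ A zero (stretch 𝟏 ⊕ A) id 1F refl (edge zero)
  (λ i → subst (λ u → Parent (stretch 𝟏 ⊕ A) u (suc (suc i)))
    (injʳ≡punchIn (parent A i)) (⊕-edgeʳ (stretch 𝟏) A i))
  where
  injʳ≡punchIn : ∀ u → injʳ (stretch 𝟏) A u ≡ punchIn 1F u
  injʳ≡punchIn zero    = refl
  injʳ≡punchIn (suc _) = refl

grow-stretch : ∀ A v → grow (stretch A) (suc v) ≅ stretch (grow A v)
-- `stretch` shifts the leaf of `grow A v` from `1F` to `2F`.
grow-stretch A v = grow-≅ (stretch A) (suc v) (stretch (grow A v)) id 2F refl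
  (edge 1F) λ { zero → edge zero ; (suc i) → edge (suc (suc i)) }

-- The non-root vertices of the left summand are numbered first, so the leaf is `1F` on both sides
-- and `id` matches the rest.
grow-⊕ˡ : ∀ A B v → grow (A ⊕ B) (injˡ A B v) ≅ grow A v ⊕ B
grow-⊕ˡ A B v = grow-≅ (A ⊕ B) (injˡ A B v) T id 1F refl
  (subst (λ u → Parent T u 1F) (sym (punchIn-injˡ v)) (⊕-edgeˡ (grow A v) B zero))
  (⊕-edge-elim A B (λ u w → Parent T (punchIn 1F u) (punchIn 1F w))
    (λ i → subst (λ u → Parent T u (suc (suc (i ↑ˡ nonRoots B))))
      (sym (punchIn-injˡ (parent A i)))
      (⊕-edgeˡ (grow A v) B (suc i)))
    (λ j → subst (λ u → Parent T u (suc (suc (nonRoots A ↑ʳ j))))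
      (sym (punchIn-injʳ (parent B j)))
      (⊕-edgeʳ (grow A v) B j)))
  where
  T = grow A v ⊕ B

  punchIn-injˡ : ∀ u → punchIn 1F (injˡ A B u) ≡ injˡ (grow A v) B (punchIn 1F u)
  punchIn-injˡ zero    = refl
  punchIn-injˡ (suc _) = refl

  punchIn-injʳ : ∀ u → punchIn 1F (injʳ A B u) ≡ injʳ (grow A v) B u
  punchIn-injʳ zero    = refl
  punchIn-injʳ (suc _) = refl

-- In a right summand the leaf would be numbered after the vertices of `A`; swapping the summands
-- reduces this case to `grow-⊕ˡ`.
grow-⊕ʳ : ∀ A B v → grow (B ⊕ A) (injˡ B A v) ≅ grow (A ⊕ B) (injʳ A B v)
grow-⊕ʳ A B v = subst (λ w → grow (B ⊕ A) (injˡ B A v) ≅ grow (A ⊕ B) w)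
  (⊕-swap-injˡ B A v) (grow-cong (⊕-comm B A) (injˡ B A v))

grow-generated : ∀ {A} → Generated A → ∀ v → Generated (grow A v)
-- This clause also settles `one`, whose only vertex is the root.
grow-generated {A} gA zero = iso (≅-sym (grow-root A)) (add (up one) gA)
grow-generated (add {A} {B} gA gB) (suc k) =
  subst (λ k → Generated (grow (A ⊕ B) (suc k)))
    (join-splitAt (nonRoots A) (nonRoots B) k) (go (splitAt (nonRoots A) k))
  where
  go : ∀ s → Generated (grow (A ⊕ B) (suc (join (nonRoots A) (nonRoots B) s)))
  go (inj₁ i) = iso (≅-sym (grow-⊕ˡ A B (suc i))) (add (grow-generated gA (suc i)) gB)
  go (inj₂ j) = iso (grow-⊕ʳ A B (suc j))
    (iso (≅-sym (grow-⊕ˡ B A (suc j))) (add (grow-generated gB (suc j)) gA))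
grow-generated (up {A} gA) (suc v) =
  iso (≅-sym (grow-stretch A v)) (up (grow-generated gA v))
grow-generated (iso {A} {B} f gA) w@(suc _) =
  subst (Generated ∘ grow B) (inverseʳ vertices)
    (iso (grow-cong f v) (grow-generated gA v))
  where
  open _≅_ f using (vertices)
  v = vertices ⟨$⟩ˡ w

-- Deleting a leaf

module Delete {n} (p : Fin (suc n) → Fin (suc (suc n)))
              (reach : ∀ v → Star (ParentOf p) zero v)
              (i : Fin (suc n)) (childless : ∀ j → p j ≢ suc i) where

  leaf : Fin (suc (suc n))
  leaf = suc i

  parent′ : Fin n → Fin (suc n)
  parent′ j = punchOut (childless (punchIn i j) ∘ sym)

  punchIn-parent′ : ∀ j → punchIn leaf (parent′ j) ≡ p (punchIn i j)
  punchIn-parent′ j = punchIn-punchOut (childless (punchIn i j) ∘ sym)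

  -- Parents are unique, so for `b = suc j` the vertex `a` must be `parent′ j`.
  edge′ : ∀ {a b} → ParentOf p (punchIn leaf a) (punchIn leaf b) → ParentOf parent′ a b
  edge′ {a} {zero}  ()
  edge′ {a} {suc j} e = subst (λ u → ParentOf parent′ u (suc j))
    (punchIn-injective leaf _ a (trans (punchIn-parent′ j)
      (parentOf-unique (edge (punchIn i j)) e)))
    (edge j)

  path-from-leaf : ∀ {x} → Star (ParentOf p) leaf x → x ≡ leaf
  path-from-leaf path = go path refl
    where
    -- The start is a variable with an equation because an `edge j` starts at `p j`, which does not
    -- unify with `leaf`.
    go : ∀ {u x} → Star (ParentOf p) u x → u ≡ leaf → x ≡ leaf
    go ε            eq = eq
    go (edge j ◅ _) eq = contradiction eq (childless j)

  -- A path that meets `leaf` has to end there, so one ending at a surviving vertex uses only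
  -- surviving edges.
  path′ : ∀ {u a b} → Star (ParentOf p) u (punchIn leaf b) → u ≡ punchIn leaf a →
          Star (ParentOf parent′) a b
  path′ {b = b} path eq = go path eq refl
    where
    go : ∀ {u x a} → Star (ParentOf p) u x → u ≡ punchIn leaf a → x ≡ punchIn leaf b →
         Star (ParentOf parent′) a b
    go {a = a} ε eq eq′ with refl ← punchIn-injective leaf a b (trans (sym eq) eq′) = ε
    go (_◅_ {j = w} e path) eq eq′ with leaf ≟ w
    ... | yes refl =
      contradiction (trans (sym eq′) (path-from-leaf path)) (punchInᵢ≢i leaf b)
    ... | no leaf≢w =
      edge′ (subst₂ (ParentOf p) eq (sym (punchIn-punchOut leaf≢w)) e)
        ◅ go path (sym (punchIn-punchOut leaf≢w)) eq′

  tree : Tree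
  tree = record
    { nonRoots  = n
    ; parent    = parent′
    ; reachable = λ v → path′ (reach (punchIn leaf v)) refl
    }

  stem : Vertex tree
  stem = punchOut (childless i ∘ sym)

  grow-stem : grow tree stem ≅ record { nonRoots = suc n ; parent = p ; reachable = reach }
  grow-stem = grow-≅ tree stem _ id leaf refl
    (subst (λ u → ParentOf p u leaf) (sym (punchIn-punchOut (childless i ∘ sym))) (edge i))
    (λ j → subst (λ u → ParentOf p u (suc (punchIn i j))) (sym (punchIn-parent′ j))
      (edge (punchIn i j)))

-- Existence of a leaf, and the induction

∃-non-value : ∀ {n} (f : Fin n → Fin (suc n)) → ∃ λ v → ¬ ∃ λ j → f j ≡ v
∃-non-value {n} f = ¬∀⟶∃¬ (suc n) (λ v → ∃ λ j → f j ≡ v) (λ v → any? (λ j → f j ≟ v))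
  -- If every value were attained, choosing preimages would inject `Fin (suc n)` into `Fin n`.
  λ onto → <⇒notInjective {f = proj₁ ∘ onto} (n<1+n n) λ {u} {v} eq →
    trans (sym (proj₂ (onto u))) (trans (cong f eq) (proj₂ (onto v)))

∃-leaf : ∀ {n} (p : Fin (suc n) → Fin (suc (suc n))) →
         (∀ v → Star (ParentOf p) zero v) → ∃ λ i → ∀ j → p j ≢ suc i
∃-leaf p reach with ∃-non-value p
... | suc i , childless = i , λ j eq → childless (j , eq)
-- The root does have a child: the path to `1F` is non-empty, and its first edge leaves the root.
... | zero  , childless = contradiction (first-step (reach 1F)) childless
  where
  first-step : Star (ParentOf p) zero 1F → ∃ λ j → p j ≡ zero
  first-step path = go path refl λ ()
    where
    go : ∀ {u v} → Star (ParentOf p) u v → u ≡ zero → v ≢ zero → ∃ λ j → p j ≡ zero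
    go ε            eq v≢0 = contradiction eq v≢0
    go (edge j ◅ _) eq _   = j , eq

generated : ∀ n (p : Fin n → Fin (suc n)) (reach : ∀ v → Star (ParentOf p) zero v) →
            Generated (record { nonRoots = n ; parent = p ; reachable = reach })
-- `p` and `reach` need not be definitionally those of `𝟏`, hence the use of `iso`.
generated zero    p reach = iso (homomorphism⇒≅ 𝟏 _ id refl λ ()) one
generated (suc n) p reach =
  iso grow-stem (grow-generated (generated n parent′ (reachable tree)) stem)
  where
  i = proj₁ (∃-leaf p reach)
  open Delete p reach i (proj₂ (∃-leaf p reach))

mainTheorem1 : ∀ (T : Tree) → Generated T
mainTheorem1 T = generated (nonRoots T) (parent T) (reachable T)
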